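{- Let $\mathcal A$ be a class of structures, let $\mathcal G$ denote $\{\mathrm{graph}(\mathrm{core}(\mathbf A))\mid\mathbf A\in\mathcal A\}$, and let $n\ge1$. The following are equivalent. 1. There exists a game vector $v$ with $n$ pebbles such that the $v$-game solves $p\text{ - }\mathrm{HOM}(\mathcal A)$. 2. The $(1,\ldots,1)$-game, with $1$ repeated $n$ times, solves $p\text{ - }\mathrm{HOM}(\mathcal A)$. 3. The class $\mathcal G$ has tree depth $<n$ (i.e. every graph in $\mathcal G$ has tree depth $<n$).
   Context: Structures are finite relational structures over finite vocabularies with non-empty universe; similar structures have the same vocabulary. A partial homomorphism from $\mathbf A$ to $\mathbf B$ is either the empty map or a homomorphism to $\mathbf B$ from the substructure of $\mathbf A$ induced on a non-empty set $\mathrm{dom}(h)\subseteq A$. A structure is a core if all its homomorphisms to itself are injective; $\mathrm{core}(\mathbf A)$ is the (unique up to isomorphism) core $\mathbf B$ with $B\subseteq A$, $R^{\mathbf B}\subseteq R^{\mathbf A}$ for all $R$, and such that $\mathbf A$ has a homomorphism to $\mathbf B$. $\mathrm{graph}(\mathbf A)$ is the Gaifman graph: vertex set $A$, an edge between distinct $a,a'$ iff they occur together in a tuple of some relation of $\mathbf A$. A game vector is a tuple $v=(p_1,\ldots,p_r)\in\mathbb N^r$ with $r\ge1$; it has $r$ rounds and $\sum_{i=1}^r p_i$ pebbles. A Duplicator winning strategy for the $v$-game on a pair $(\mathbf A,\mathbf B)$ of similar structures is a sequence $(W_1,\ldots,W_r)$ of sets of partial homomorphisms from $\mathbf A$ to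 $\mathbf B$ such that: for all $S\subseteq A$ with $|S|\le p_1$, $W_1$ contains a mapping with domain $S$; and for all $1\le i\le r-1$, all $g\in W_i$ and all $S$ with $\mathrm{dom}(g)\subseteq S\subseteq A$ and $|S\setminus\mathrm{dom}(g)|\le p_{i+1}$, there is an extension $g'\in W_{i+1}$ of $g$ with domain $S$. The $v$-game solves $p\text{ - }\mathrm{HOM}(\mathcal A)$ if for every $\mathbf A\in\mathcal A$ and every $\mathbf B$ similar to $\mathbf A$, the existence of a Duplicator winning strategy for the $v$-game on $(\mathbf A,\mathbf B)$ implies that there is a homomorphism from $\mathbf A$ to $\mathbf B$. The height of a rooted tree is the maximum number of edges on a path from the root to a vertex. The tree depth of a connected graph $\mathbf G$ is the least $h\in\mathbb N$ such that there is a rooted tree on vertex set $G$ of height $\le h$ such that for every edge of $\mathbf G$ one endpoint is an ancestor of the other in the rooted tree (so a single vertex has tree depth $0$); the tree depth of a graph is the maximum over its components. -}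

module Defs where

open import Data.Bool.Base using (Bool; T)
open import Data.Fin.Base using (Fin; zero; suc; inject₁)
open import Data.Fin.Subset using (Subset; _⊆_; _─_; ∣_∣; Empty; Nonempty)
open import Data.Maybe.Base using (Maybe; just; nothing; is-just)
open import Data.Nat.Base using (ℕ; zero; suc; _≤_; NonZero)
open import Data.Product.Base using (Σ; ∃; ∃-syntax; Σ-syntax; _×_; _,_; proj₁; proj₂)
open import Data.Sum.Base using (_⊎_)
open import Data.Vec.Base using (Vec; lookup; map; replicate; sum; tabulate)
open import Data.Vec.Membership.Propositional using (_∈_)
open import Function.Base using (_∘_; _on_)
open import Function.Bundles using (_⇔_)
open import Function.Definitions using (Injective)
open import Level using (Level; 0ℓ; _⊔_) renaming (suc to lsuc)
open import Relation.Binary.Construct.Closure.ReflexiveTransitive using (Star)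
open import Relation.Binary.Core using (Rel)
open import Relation.Binary.Definitions using (Symmetric; Irreflexive)
open import Relation.Binary.PropositionalEquality.Core using (_≡_; _≢_; refl; ≢-sym)
open import Relation.Unary using (Pred)

private
  variable
    ℓ : Level

------------------------------------------------------------------------
-- Structures

record Vocabulary : Set where
  field
    symbols : ℕ
    arity   : Fin symbols → ℕ

open Vocabulary public

-- Universes are taken to be initial segments of ℕ, so that every finite
-- structure is represented up to isomorphism.
record Structure (σ : Vocabulary) : Set where
  field
    size     : ℕ
    nonEmpty : NonZero size
    rel      : (R : Fin (symbols σ)) → Vec (Fin size) (arity σ R) → Bool

  Universe : Set
  Universe = Fin size

  Holds : (R : Fin (symbols σ)) → Vec Universe (arity σ R) → Set
  Holds R t = T (rel R t)

open Structure public using (Universe; Holds)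

-- A class may contain structures over different vocabularies.
StructureClass : (ℓ : Level) → Set (lsuc ℓ)
StructureClass ℓ = (σ : Vocabulary) → Structure σ → Set ℓ

module _ {σ : Vocabulary} where

  IsHom : (A B : Structure σ) → (Universe A → Universe B) → Set
  IsHom A B h = ∀ R t → Holds A R t → Holds B R (map h t)

  Hom : (A B : Structure σ) → Set
  Hom A B = ∃[ h ] IsHom A B h

  IsCore : Structure σ → Set
  IsCore A = ∀ h → IsHom A A h → Injective _≡_ _≡_ h

  -- C ⊆ A together with R^C ⊆ R^A for all R.  As universes are initial
  -- segments of ℕ, the inclusion of universes is an arbitrary injection.
  -- The substructure need not be induced.
  _IsSubstructureOf_ : (C A : Structure σ) → Set
  C IsSubstructureOf A = ∃[ ι ] Injective _≡_ _≡_ ι × IsHom C A ι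

  -- The core of A is only determined up to isomorphism, hence a relation.
  _IsCoreOf_ : (C A : Structure σ) → Set
  C IsCoreOf A = IsCore C × C IsSubstructureOf A × Hom A C

------------------------------------------------------------------------
-- Games

dom : ∀ {m} {Y : Set} → (Fin m → Maybe Y) → Subset m
dom f = tabulate (is-just ∘ f)

module _ {σ : Vocabulary} where

  -- The equation  map f t ≡ map just s  says that all entries of t are in
  -- the domain of f, with image s.  A nullary relation constrains every
  -- non-empty map but not the empty one.
  IsPartialHom : (A B : Structure σ) → (Universe A → Maybe (Universe B)) → Set
  IsPartialHom A B f =
    Empty (dom f) ⊎
    (Nonempty (dom f) ×
     (∀ R t s → Holds A R t → map f t ≡ map just s → Holds B R s))

  record PartialHom (A B : Structure σ) : Set where
    constructor partialHom
    field
      apply  : Universe A → Maybe (Universe B)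
      isPHom : IsPartialHom A B apply

    domain : Subset (Structure.size A)
    domain = dom apply

  open PartialHom public

  _Extends_ : {A B : Structure σ} → PartialHom A B → PartialHom A B → Set
  g′ Extends g = ∀ a b → apply g a ≡ just b → apply g′ a ≡ just b

-- (r , p) is a game vector with r + 1 rounds.
GameVector : Set
GameVector = Σ[ r ∈ ℕ ] Vec ℕ (suc r)

pebbles : GameVector → ℕ
pebbles (_ , p) = sum p

ones : (n : ℕ) .{{_ : NonZero n}} → GameVector
ones (suc n) = n , replicate (suc n) 1

record WinningStrategy {σ : Vocabulary} (v : GameVector) (A B : Structure σ) :
       Set₁ where
  private
    r = proj₁ v
    p = lookup (proj₂ v)
  field
    W       : Fin (suc r) → Pred (PartialHom A B) 0ℓ
    initial : (S : Subset (Structure.size A)) → ∣ S ∣ ≤ p zero →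
              ∃[ g ] W zero g × domain g ≡ S
    forth   : (i : Fin r) (g : PartialHom A B) → W (inject₁ i) g →
              (S : Subset (Structure.size A)) → domain g ⊆ S →
              ∣ S ─ domain g ∣ ≤ p (suc i) →
              ∃[ g′ ] W (suc i) g′ × domain g′ ≡ S × g′ Extends g

Solves : GameVector → StructureClass ℓ → Set (lsuc 0ℓ ⊔ ℓ)
Solves v 𝒜 = ∀ σ (A B : Structure σ) → 𝒜 σ A → WinningStrategy v A B → Hom A B

------------------------------------------------------------------------
-- Graphs

record Graph : Set₁ where
  field
    Vertex : Set
    _~_    : Rel Vertex 0ℓ
    sym    : Symmetric _~_
    irrefl : Irreflexive _≡_ _~_

open Graph public using (Vertex)

gaifman : {σ : Vocabulary} → Structure σ → Graph
gaifman {σ} A = record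
  { Vertex = Universe A
  ; _~_    = λ a a′ → a ≢ a′ × ∃[ R ] ∃[ t ] Holds A R t × a ∈ t × a′ ∈ t
  ; sym    = λ (a≢a′ , R , t , Rt , a∈t , a′∈t) →
               ≢-sym a≢a′ , R , t , Rt , a′∈t , a∈t
  ; irrefl = λ a≡a′ (a≢a′ , _) → a≢a′ a≡a′
  }

data CoreGraphs (𝒜 : StructureClass ℓ) : Pred Graph ℓ where
  graphOfCore : ∀ {σ} {A C : Structure σ} → 𝒜 σ A → C IsCoreOf A →
                CoreGraphs 𝒜 (gaifman C)

-- The subset is Boolean-valued so that a vertex of the induced subgraph is
-- determined by the underlying vertex.
induced : (G : Graph) → (Vertex G → Bool) → Graph
induced G S = record
  { Vertex = Σ (Vertex G) (T ∘ S)
  ; _~_    = Graph._~_ G on proj₁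
  ; sym    = Graph.sym G
  ; irrefl = λ { refl → Graph.irrefl G refl }
  }

-- Connected components are the reachability classes of vertices.
IsComponent : (G : Graph) → (Vertex G → Bool) → Set
IsComponent G S = ∃[ v ] ∀ u → T (S u) ⇔ Star (Graph._~_ G) v u

------------------------------------------------------------------------
-- Tree depth

-- Path parent u v k: starting at u one reaches v by going down k edges.
data Path {V : Set} (parent : V → Maybe V) (u : V) : V → ℕ → Set where
  here : Path parent u u 0
  down : ∀ {v w k} → Path parent u v k → parent w ≡ just v →
         Path parent u w (suc k)

-- A rooted tree is given by its parent function.  Since the root has no
-- parent and all vertices lie below it, there are no cycles, and the root is
-- the only vertex without a parent.
record RootedTree (V : Set) : Set where
  field
    root        : V
    parent      : V → Maybe V
    root-parent : parent root ≡ nothing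
    rooted      : ∀ v → ∃[ k ] Path parent root v k

  Ancestor : Rel V 0ℓ
  Ancestor u v = ∃[ k ] Path parent u v k

  Height≤ : ℕ → Set
  Height≤ h = ∀ v k → Path parent root v k → k ≤ h

HasTreeOfHeight≤ : Graph → ℕ → Set
HasTreeOfHeight≤ G h =
  Σ[ F ∈ RootedTree (Vertex G) ] RootedTree.Height≤ F h ×
    (∀ u v → Graph._~_ G u v →
       RootedTree.Ancestor F u v ⊎ RootedTree.Ancestor F v u)

IsLeast : Pred ℕ 0ℓ → Pred ℕ 0ℓ
IsLeast P h = P h × (∀ k → P k → h ≤ k)

IsGreatest : Pred ℕ ℓ → Pred ℕ ℓ
IsGreatest P h = P h × (∀ k → P k → k ≤ h)

ConnectedTreeDepth : Graph → Pred ℕ 0ℓ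
ConnectedTreeDepth G = IsLeast (HasTreeOfHeight≤ G)

TreeDepth : Graph → Pred ℕ 0ℓ
TreeDepth G = IsGreatest λ h →
  ∃[ S ] IsComponent G S × ConnectedTreeDepth (induced G S) h

{-# OPTIONS --safe #-}

-- If each component of the Gaifman graph of a core C of A has an elimination
-- tree of height < n, Duplicator's answers along the branches of these trees
-- agree where they overlap, and every tuple of C lies on one branch; so a
-- winning strategy for n single pebbles yields a homomorphism C → B, hence A → B.
-- Conversely, Duplicator wins against the unravelling of C, whose elements are
-- the sequences of at most n vertices of C and whose tuples are pairwise
-- prefix-comparable.  A homomorphism from C to the unravelling followed by the
-- last-entry map is injective because C is a core, so the prefix order pulls
-- back to an order on C whose chains give elimination trees of height < n.
-- A round with p pebbles is simulated by p rounds with one pebble.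

module Submission where

open import Defs
open import Axiom.UniquenessOfIdentityProofs.WithK using (uip)
open import Data.Bool.Base using (Bool; true; false; T; if_then_else_)
open import Data.Bool.Properties using (T?; T-irrelevant)
open import Data.Fin.Base as FinBase
  using (Fin; zero; suc; toℕ; fromℕ<; inject₁; punchIn; punchOut; combine;
         remQuot; finToFun; funToFin)
open import Data.Fin.Properties as Fin using (any?; all?)
open import Data.Fin.Subset
  using (Subset; inside; outside; _∪_; _─_; ⁅_⁆; ∣_∣; Empty)
  renaming (_∈_ to _∈ˢ_; _⊆_ to _⊆ˢ_)
open import Data.Fin.Subset.Properties
  using (p⊆q⇒∣p∣≤∣q∣; ∣⁅x⁆∣≡1; x∈⁅x⁆; p⊆p∪q; q⊆p∪q; x∈p∪q⁻; p─q⊆p; ∣p─q∣≤∣p∣;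
         p─⊥≡p; p─q─r≡p─q∪r; x∈p∧x∉q⇒x∈p─q; x∈p∧x≢y⇒x∈p-y; x∈p⇒∣p-x∣<∣p∣;
         nonempty?; ⊆-antisym; ⊥⊆)
  renaming (_∈?_ to _∈ˢ?_)
open import Data.List.Base using (List; []; _∷_; allFin; cartesianProduct)
open import Data.List.Extrema.Nat using (argmax; f[xs]≤f[argmax])
open import Data.List.Membership.Propositional.Properties
  using (∈-allFin; ∈-cartesianProduct⁺)
open import Data.List.Relation.Unary.All as All using (All; []; _∷_)
open import Data.Maybe.Base as Maybe using (Maybe; just; nothing; is-just; fromMaybe)
open import Data.Maybe.Properties using (just-injective)
open import Data.Nat.Base
  using (ℕ; zero; suc; _+_; _*_; _^_; _≤_; _<_; NonZero; >-nonZero⁻¹; z≤n; s≤s)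
open import Data.Nat.Properties as ℕ using (anyUpTo?)
open import Data.Product.Base using (Σ; ∃; ∃-syntax; Σ-syntax; _×_; _,_; proj₁; proj₂)
open import Data.Sum.Base as Sum using (_⊎_; inj₁; inj₂; [_,_]′)
open import Data.Unit.Base using (tt)
open import Data.Vec.Base
  using (Vec; []; _∷_; here; there; lookup; tabulate; map; replicate; sum)
import Data.Vec.Membership.DecPropositional as VecMembership
open import Data.Vec.Membership.Propositional using (_∈_)
open import Data.Vec.Membership.Propositional.Properties using (∈-map⁺)
open import Data.Vec.Properties
  using (lookup∘tabulate; tabulate∘lookup; tabulate-cong; lookup-replicate;
         map-∘; map-cong; map-id; ∷-injectiveˡ; ∷-injectiveʳ; []=⇒lookup;
         lookup⇒[]=)
open import Data.Vec.Relation.Unary.All as AllV using ([]; _∷_) renaming (All to AllV)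
open import Data.Vec.Relation.Unary.Any using (here; there)
open import Function.Base using (_∘_; id; const; _on_)
open import Function.Bundles using (_⇔_; mk⇔; Equivalence)
open import Function.Definitions using (Injective)
open import Level using (Level; 0ℓ)
open import Relation.Binary.Construct.Closure.ReflexiveTransitive
  using (Star; ε; _◅_; _◅◅_; reverse)
open import Relation.Binary.Core using (Rel)
open import Relation.Binary.Definitions
  using (Symmetric; Irreflexive; Transitive; DecidableEquality; tri<; tri≈; tri>)
  renaming (Decidable to Decidable₂)
open import Relation.Binary.PropositionalEquality
  using (_≡_; _≢_; _≗_; refl; sym; trans; cong; cong₂; subst)
open import Relation.Nullary using (¬_; Dec; yes; no; contradiction)
open import Relation.Nullary.Decidable
  using (map′; ¬?; _×-dec_; _⊎-dec_; _→-dec_; decidable-stable; ⌊_⌋; toWitness;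
         fromWitness)
open import Relation.Unary using (Pred; Decidable)

private
  variable
    V X Y : Set
    G H : Graph
    u v w : V
    π : V → Maybe V
    h j k m n : ℕ

-- Finite search

-- Least tree heights and cores are found by exhaustive search, which needs existential statements
-- over finite types to be decidable.
Searchable : Set → Set₁
Searchable X = {P : Pred X 0ℓ} → Decidable P → Dec (∃ P)

search-∀ : Searchable X → {P : Pred X 0ℓ} → Decidable P → Dec (∀ x → P x)
search-∀ search P? = map′
  (λ ¬∃¬ x → decidable-stable (P? x) (λ ¬p → ¬∃¬ (x , ¬p)))
  (λ ∀p (x , ¬p) → ¬p (∀p x))
  (¬? (search (¬? ∘ P?)))

search-Fin : Searchable (Fin n)
search-Fin = any?

search-T : ∀ b → Searchable (T b)
search-T false P? = no λ ()
search-T true  P? = map′ (tt ,_) proj₂ (P? tt)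

search-Σ : {Y : X → Set} → Searchable X → (∀ x → Searchable (Y x)) → Searchable (Σ X Y)
search-Σ searchX searchY P? = map′
  (λ (x , y , p) → (x , y) , p) (λ ((x , y) , p) → x , y , p)
  (searchX λ x → searchY x λ y → P? (x , y))

search-Maybe : Searchable X → Searchable (Maybe X)
search-Maybe search P? = map′
  [ (nothing ,_) , (λ (x , p) → just x , p) ]′
  (λ { (nothing , p) → inj₁ p ; (just x , p) → inj₂ (x , p) })
  (P? nothing ⊎-dec search (P? ∘ just))

search-Vec : Searchable X → Searchable (Vec X n)
search-Vec {n = zero}  search P? = map′ ([] ,_) (λ { ([] , p) → p }) (P? [])
search-Vec {n = suc n} search P? = map′
  (λ (x , xs , p) → x ∷ xs , p) (λ { (x ∷ xs , p) → x , xs , p })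
  (search λ x → search-Vec search λ xs → P? (x ∷ xs))

-- A function on `Fin n` is recovered from its vector of values only up to pointwise equality, which
-- is why `P` has to respect `≗`.
search-Π : Searchable X → {P : Pred (Fin n → X) 0ℓ} → (∀ {f g} → f ≗ g → P f → P g) →
           Decidable P → Dec (∃ P)
search-Π search resp P? = map′
  (λ (xs , p) → lookup xs , p)
  (λ (f , p) → tabulate f , resp (sym ∘ lookup∘tabulate f) p)
  (search-Vec search (P? ∘ lookup))

least : {P : Pred ℕ 0ℓ} → Decidable P → P n → ∃[ k ] IsLeast P k × k ≤ n
least {n} {P} P? p with P? 0
least {n} P? p | yes p₀ = 0 , (p₀ , λ _ _ → z≤n) , z≤n
least {zero} P? p | no ¬p₀ = contradiction p ¬p₀
least {suc n} {P} P? p | no ¬p₀ with least {n} {P ∘ suc} (P? ∘ suc) p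
... | k , (pₖ , min) , k≤n =
  suc k , (pₖ , λ { zero p₀ → contradiction p₀ ¬p₀ ; (suc l) q → s≤s (min l q) }) , s≤s k≤n

-- Rooted trees

path-++ : Path π u v j → Path π v w k → Path π u w (k + j)
path-++ P here       = P
path-++ P (down Q e) = down (path-++ P Q) e

-- The parent function determines the last step, and the orphan `u` cannot be passed on the way up.
-- Length and path are compared as a pair so that one match identifies both.
path-unique : π u ≡ nothing → (P : Path π u v j) (Q : Path π u v k) →
              _≡_ {A = ∃ (Path π u v)} (j , P) (k , Q)
path-unique orphan here       here        = refl
path-unique orphan here       (down _ e)  = contradiction (trans (sym orphan) e) λ ()
path-unique orphan (down _ e) here        = contradiction (trans (sym orphan) e) λ ()
path-unique orphan (down P e) (down Q e′) with just-injective (trans (sym e) e′)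
path-unique orphan (down P e) (down Q e′) | refl with path-unique orphan P Q
... | refl = cong (λ e → _ , down P e) (uip e e′)

path-map : ∀ {V V′ : Set} {parent : V → Maybe V} {parent′ : V′ → Maybe V′} (f : V → V′) →
           parent′ ∘ f ≗ Maybe.map f ∘ parent →
           ∀ {u v k} → Path parent u v k → Path parent′ (f u) (f v) k
path-map f comm here       = here
path-map f comm (down P e) = down (path-map f comm P) (trans (comm _) (cong (Maybe.map f) e))

path-resp : ∀ {V : Set} {p q : V → Maybe V} → p ≗ q → ∀ {u v k} → Path p u v k → Path q u v k
path-resp p≗q here       = here
path-resp p≗q (down P e) = down (path-resp p≗q P) (trans (sym (p≗q _)) e)

path? : DecidableEquality V → (parent : V → Maybe V) → ∀ u v → Decidable (Path parent u v)
path? _≟_ parent u v zero    = map′ (λ { refl → here }) (λ { here → refl }) (u ≟ v)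
path? _≟_ parent u v (suc k) with parent v in eq
... | nothing = no λ { (down _ e) → contradiction (trans (sym eq) e) λ () }
... | just w  = map′ (λ P → down P eq)
  (λ { (down P e) → subst (λ x → Path parent u x k) (just-injective (trans (sym e) eq)) P })
  (path? _≟_ parent u w k)

hasTree-mono : h ≤ k → HasTreeOfHeight≤ G h → HasTreeOfHeight≤ G k
hasTree-mono h≤k (F , height , anc) = F , (λ v l P → ℕ.≤-trans (height v l P) h≤k) , anc

-- Different Boolean predicates may cut out the same component, and the induced graphs then have
-- different vertex types; this moves trees between them. The height bound survives because, paths
-- being unique, every path from the new root is the image of an old one.
hasTree-map : (f : Vertex G → Vertex H) (g : Vertex H → Vertex G) → f ∘ g ≗ id → g ∘ f ≗ id →
              (∀ {u v} → Graph._~_ H u v → Graph._~_ G (g u) (g v)) →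
              HasTreeOfHeight≤ G h → HasTreeOfHeight≤ H h
hasTree-map {G} {H} {h} f g fg gf g-hom (F , height , anc) = F′ , height′ , anc′
  where
  open RootedTree F
  parent′ = Maybe.map f ∘ parent ∘ g

  image : ∀ {u v k} → Path parent (g u) (g v) k → Path parent′ u v k
  image {u} {v} {k} P = subst (λ x → Path parent′ x v k) (fg u)
    (subst (λ x → Path parent′ (f (g u)) x k) (fg v)
      (path-map f (cong (Maybe.map f ∘ parent) ∘ gf) P))

  root-image : ∀ v → ∃[ k ] Path parent root (g v) k × Path parent′ (f root) v k
  root-image v with rooted (g v)
  ... | k , P = k , P , image (subst (λ x → Path parent x (g v) k) (sym (gf root)) P)

  F′ : RootedTree (Vertex H)
  F′ = record
    { root        = f root
    ; parent      = parent′
    ; root-parent = cong (Maybe.map f) (trans (cong parent (gf root)) root-parent)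
    ; rooted      = λ v → let k , _ , P′ = root-image v in k , P′
    }

  height′ : RootedTree.Height≤ F′ h
  height′ v k Q with root-image v
  ... | l , P , P′ with path-unique (RootedTree.root-parent F′) P′ Q
  ... | refl = height (g v) l P

  anc′ : ∀ u v → Graph._~_ H u v → RootedTree.Ancestor F′ u v ⊎ RootedTree.Ancestor F′ v u
  anc′ u v e = Sum.map (λ (k , P) → k , image P) (λ (k , P) → k , image P)
    (anc (g u) (g v) (g-hom e))

-- Deciding whether a tree of bounded height exists

module _ {n : ℕ} (S : Fin n → Bool) where

  ΣT-≡ : {u v : Σ (Fin n) (T ∘ S)} → proj₁ u ≡ proj₁ v → u ≡ v
  ΣT-≡ {u , p} {_ , q} refl = cong (u ,_) (T-irrelevant p q)

  search-ΣT : Searchable (Σ (Fin n) (T ∘ S))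
  search-ΣT = search-Σ search-Fin (search-T ∘ S)

  ΣT-≟ : DecidableEquality (Σ (Fin n) (T ∘ S))
  ΣT-≟ u v = map′ ΣT-≡ (cong proj₁) (proj₁ u Fin.≟ proj₁ v)

  -- The search runs over functions on `Fin n`, while parent functions live on the vertices in `S`;
  -- each of these is the restriction of its extension.
  extend : (Σ (Fin n) (T ∘ S) → Maybe X) → Fin n → Maybe X
  extend f i with T? (S i)
  ... | yes p = f (i , p)
  ... | no _  = nothing

  extend-proj₁ : (f : Σ (Fin n) (T ∘ S) → Maybe X) → f ≗ extend f ∘ proj₁
  extend-proj₁ f (i , p) with T? (S i)
  ... | yes q = cong (f ∘ (i ,_)) (T-irrelevant p q)
  ... | no ¬p = contradiction p ¬p

-- Path lengths are bounded to make this decidable.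
TreeWithin : (G : Graph) → ℕ → Vertex G → (Vertex G → Maybe (Vertex G)) → Set
TreeWithin G h root parent =
  parent root ≡ nothing × (∀ v → root ⊑ v) × (∀ u v → Graph._~_ G u v → u ⊑ v ⊎ v ⊑ u)
  where
  _⊑_ : Rel (Vertex G) 0ℓ
  u ⊑ v = ∃[ k ] k < suc h × Path parent u v k

treeWithin-resp : ∀ G {r} {p q : Vertex G → Maybe (Vertex G)} → p ≗ q →
                  TreeWithin G h r p → TreeWithin G h r q
treeWithin-resp G {r} p≗q (orphan , rooted , anc) =
  trans (sym (p≗q r)) orphan , resp ∘ rooted , λ u v e → Sum.map resp resp (anc u v e)
  where
  resp : ∀ {u v} → ∃[ k ] k < _ × Path _ u v k → ∃[ k ] k < _ × Path _ u v k
  resp (k , k<h , P) = k , k<h , path-resp p≗q P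

treeWithin⇒hasTree : ∀ {r p} → TreeWithin G h r p → HasTreeOfHeight≤ G h
treeWithin⇒hasTree {G} {h} {r} {p} (orphan , rooted , anc) = F , height , λ u v e →
  Sum.map (λ (k , _ , P) → k , P) (λ (k , _ , P) → k , P) (anc u v e)
  where
  F : RootedTree (Vertex G)
  F = record { root = r ; parent = p ; root-parent = orphan
             ; rooted = λ v → let k , _ , P = rooted v in k , P }

  height : RootedTree.Height≤ F h
  height v k Q with rooted v
  ... | l , s≤s l≤h , P with path-unique orphan P Q
  ... | refl = l≤h

hasTree⇒treeWithin : ((F , _) : HasTreeOfHeight≤ G h) →
                     TreeWithin G h (RootedTree.root F) (RootedTree.parent F)
hasTree⇒treeWithin {G} {h} (F , height , anc) =
  root-parent , (λ v → bound (rooted v)) , λ u v e → Sum.map bound bound (anc u v e)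
  where
  open RootedTree F
  bound : ∀ {u v} → Ancestor u v → ∃[ k ] k < suc h × Path parent u v k
  -- Prolonged upwards to the root, the path has length `k + l`, which is at most `h`.
  bound {u} {v} (k , P) = let l , Q = rooted u in
    k , s≤s (ℕ.m+n≤o⇒m≤o k (height v (k + l) (path-++ Q P))) , P

hasTree? : {_~_ : Rel (Fin n) 0ℓ} (~-sym : Symmetric _~_) (~-irrefl : Irreflexive _≡_ _~_) →
           Decidable₂ _~_ → (S : Fin n → Bool) →
           let G = record { Vertex = Fin n ; _~_ = _~_ ; sym = ~-sym ; irrefl = ~-irrefl } in
           Decidable (HasTreeOfHeight≤ (induced G S))
hasTree? {n} {_~_} ~-sym ~-irrefl _~?_ S h = map′
  (λ (r , p , t) → treeWithin⇒hasTree {K} t)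
  (λ t → RootedTree.root (proj₁ t) , extend S (RootedTree.parent (proj₁ t)) ,
         treeWithin-resp K (extend-proj₁ S _) (hasTree⇒treeWithin {K} t))
  (search λ r → search-Π (search-Maybe search) (λ p≗q → treeWithin-resp K (p≗q ∘ proj₁)) λ p →
    treeWithin? r (p ∘ proj₁))
  where
  K = induced (record { Vertex = Fin n ; _~_ = _~_ ; sym = ~-sym ; irrefl = ~-irrefl }) S
  search = search-ΣT S

  treeWithin? : ∀ r → Decidable (TreeWithin K h r)
  treeWithin? r p = isNothing? (p r)
    ×-dec search-∀ search (r ⊑?_)
    ×-dec search-∀ search λ u → search-∀ search λ v →
      (proj₁ u ~? proj₁ v) →-dec ((u ⊑? v) ⊎-dec (v ⊑? u))
    where
    _⊑?_ : Decidable₂ λ u v → ∃[ k ] k < suc h × Path p u v k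
    u ⊑? v = anyUpTo? (path? (ΣT-≟ S) p u v) (suc h)

    isNothing? : (x : Maybe (Vertex K)) → Dec (x ≡ nothing)
    isNothing? nothing  = yes refl
    isNothing? (just _) = no λ ()

-- Elimination orders

-- A strict forest order, which is easier to restrict and to pull back than a parent function: by
-- `semilinear` the vertices below a given one form a chain. `depth` is any strictly monotone rank
-- and need not count predecessors.
record EliminationOrder (G : Graph) (h : ℕ) : Set₁ where
  open Graph G using (_~_)
  field
    _⊏_        : Rel (Vertex G) 0ℓ
    _⊏?_       : Decidable₂ _⊏_
    ⊏-trans    : Transitive _⊏_
    semilinear : ∀ {u v w} → u ⊏ w → v ⊏ w → u ⊏ v ⊎ u ≡ v ⊎ v ⊏ u
    comparable : ∀ {u v} → u ~ v → u ⊏ v ⊎ v ⊏ u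
    depth      : Vertex G → ℕ
    depth-mono : ∀ {u v} → u ⊏ v → depth u < depth v
    depth≤     : ∀ v → depth v ≤ h

module _ {G : Graph} {h : ℕ} (search : Searchable (Vertex G)) (order : EliminationOrder G h) where
  open EliminationOrder order
  open Graph G using (_~_)

  private
    IsPredecessor : Rel (Vertex G) 0ℓ
    IsPredecessor w v = w ⊏ v × (∀ u → u ⊏ v → u ≡ w ⊎ u ⊏ w)

    -- Each vertex found strictly between `w` and `v` has greater depth than `w` but less than `v`,
    -- so `fuel` bounds the climb. Once there is none, semilinearity puts everything below `v` at or
    -- below `w`.
    climb : ∀ fuel {v w} → w ⊏ v → depth v ≤ fuel + depth w → ∃[ x ] IsPredecessor x v
    climb zero w⊏v v≤w = contradiction v≤w (ℕ.<⇒≱ (depth-mono w⊏v))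
    climb (suc fuel) {v} {w} w⊏v v≤w with search (λ u → (w ⊏? u) ×-dec (u ⊏? v))
    ... | yes (u , w⊏u , u⊏v) = climb fuel u⊏v
      (ℕ.≤-trans v≤w (ℕ.≤-trans (ℕ.≤-reflexive (sym (ℕ.+-suc fuel _)))
                                (ℕ.+-monoʳ-≤ fuel (depth-mono w⊏u))))
    ... | no ∄between = w , w⊏v , λ u u⊏v → below u u⊏v (semilinear u⊏v w⊏v)
      where
      below : ∀ u → u ⊏ v → u ⊏ w ⊎ u ≡ w ⊎ w ⊏ u → u ≡ w ⊎ u ⊏ w
      below u _   (inj₁ u⊏w)        = inj₂ u⊏w
      below u _   (inj₂ (inj₁ u≡w)) = inj₁ u≡w
      below u u⊏v (inj₂ (inj₂ w⊏u)) = contradiction (u , w⊏u , u⊏v) ∄between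

    predecessor : ∀ v → (∃[ w ] IsPredecessor w v) ⊎ (∀ u → ¬ u ⊏ v)
    predecessor v with search (_⊏? v)
    ... | yes (w , w⊏v) = inj₁ (climb (depth v) w⊏v (ℕ.m≤m+n (depth v) (depth w)))
    ... | no ∄below     = inj₂ λ u u⊏v → ∄below (u , u⊏v)

    parentOf : (∃[ w ] IsPredecessor w v) ⊎ (∀ u → ¬ u ⊏ v) → Maybe (Vertex G)
    parentOf = [ just ∘ proj₁ , const nothing ]′

    -- Each step to the parent lowers `depth`, which both bounds the recursion and limits the length
    -- of the path.
    path : ∀ fuel {u v} → depth v ≤ fuel → u ≡ v ⊎ u ⊏ v →
           ∃[ k ] k ≤ depth v × Path (parentOf ∘ predecessor) u v k
    path fuel v≤f (inj₁ refl) = 0 , z≤n , here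
    path zero v≤f (inj₂ u⊏v) = contradiction (ℕ.≤-trans (depth-mono u⊏v) v≤f) λ ()
    path (suc fuel) {u} {v} v≤f (inj₂ u⊏v) with predecessor v in eq
    ... | inj₂ ∄below = contradiction u⊏v (∄below u)
    ... | inj₁ (w , w⊏v , max) =
      let k , k≤w , P = path fuel {u} {w} (ℕ.≤-pred (ℕ.≤-trans (depth-mono w⊏v) v≤f)) (max u u⊏v)
      in suc k , ℕ.≤-trans (s≤s k≤w) (depth-mono w⊏v) , down P (cong parentOf eq)

    minimal : ∀ fuel v → depth v ≤ fuel → ∃[ r ] (∀ u → ¬ u ⊏ r) × (r ≡ v ⊎ r ⊏ v)
    minimal fuel v v≤f with predecessor v
    minimal fuel       v v≤f | inj₂ ∄below = v , ∄below , inj₁ refl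
    minimal zero       v v≤f | inj₁ (w , w⊏v , _) =
      contradiction (ℕ.≤-trans (depth-mono w⊏v) v≤f) λ ()
    minimal (suc fuel) v v≤f | inj₁ (w , w⊏v , _)
      with minimal fuel w (ℕ.≤-pred (ℕ.≤-trans (depth-mono w⊏v) v≤f))
    ... | r , min , inj₁ refl = r , min , inj₂ w⊏v
    ... | r , min , inj₂ r⊏w  = r , min , inj₂ (⊏-trans r⊏w w⊏v)

    -- A walk cannot leave the part above a minimal `r`: an edge from `u` leads up, or down to a
    -- vertex on the same chain below `u` as `r`, which cannot lie under `r`. In a connected graph
    -- `r` is therefore a root.
    reach : ∀ {r u v} → (∀ w → ¬ w ⊏ r) → r ≡ u ⊎ r ⊏ u → Star _~_ u v → r ≡ v ⊎ r ⊏ v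
    reach min r⊑u ε = r⊑u
    reach {r} {u} min r⊑u (_◅_ {j = w} u~w w⋯v) = reach min (step r⊑u (comparable u~w)) w⋯v
      where
      step : r ≡ u ⊎ r ⊏ u → u ⊏ w ⊎ w ⊏ u → r ≡ w ⊎ r ⊏ w
      step (inj₁ refl) (inj₁ u⊏w) = inj₂ u⊏w
      step (inj₁ refl) (inj₂ w⊏u) = contradiction w⊏u (min w)
      step (inj₂ r⊏u)  (inj₁ u⊏w) = inj₂ (⊏-trans r⊏u u⊏w)
      step (inj₂ r⊏u)  (inj₂ w⊏u) with semilinear r⊏u w⊏u
      ... | inj₁ r⊏w        = inj₂ r⊏w
      ... | inj₂ (inj₁ r≡w) = inj₁ r≡w
      ... | inj₂ (inj₂ w⊏r) = contradiction w⊏r (min w)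

  eliminationOrder⇒hasTree : ∀ v → (∀ u → Star _~_ v u) → HasTreeOfHeight≤ G h
  eliminationOrder⇒hasTree v connected =
    treeWithin⇒hasTree {G} (orphan (predecessor root) ,
      (λ u → bounded (reach min r⊑v (connected u))) ,
      λ u w u~w → Sum.map (bounded ∘ inj₂) (bounded ∘ inj₂) (comparable u~w))
    where
    root = proj₁ (minimal (depth v) v ℕ.≤-refl)
    min  = proj₁ (proj₂ (minimal (depth v) v ℕ.≤-refl))
    r⊑v  = proj₂ (proj₂ (minimal (depth v) v ℕ.≤-refl))

    orphan : (p : (∃[ w ] IsPredecessor w root) ⊎ (∀ u → ¬ u ⊏ root)) → parentOf p ≡ nothing
    orphan (inj₁ (w , w⊏r , _)) = contradiction w⊏r (min w)
    orphan (inj₂ _)             = refl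

    bounded : ∀ {u w} → u ≡ w ⊎ u ⊏ w →
              ∃[ k ] k < suc h × Path (parentOf ∘ predecessor) u w k
    bounded {u} {w} u⊑w = let k , k≤w , P = path (depth w) ℕ.≤-refl u⊑w in
      k , s≤s (ℕ.≤-trans k≤w (depth≤ w)) , P

-- Tree depth of finite graphs

module FiniteGraph {n : ℕ} {_~_ : Rel (Fin n) 0ℓ} (~-sym : Symmetric _~_)
                   (~-irrefl : Irreflexive _≡_ _~_) (_~?_ : Decidable₂ _~_) where

  graph : Graph
  graph = record { Vertex = Fin n ; _~_ = _~_ ; sym = ~-sym ; irrefl = ~-irrefl }

  private
    -- Pairs are absorbed one by one: if `a ~ b`, the class of `a` is redirected to the
    -- representative of `b`. Run over all pairs, this yields representatives that are reachable and
    -- constant along edges.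
    merge : (es : List (Fin n × Fin n)) → Σ[ f ∈ (Fin n → Fin n) ]
            (∀ v → Star _~_ v (f v)) × All (λ (u , v) → u ~ v → f u ≡ f v) es
    merge [] = id , (λ _ → ε) , []
    merge ((a , b) ∷ es) with merge es | a ~? b
    ... | f , reach , all | no a≁b = f , reach , (λ a~b → contradiction a~b a≁b) ∷ all
    ... | f , reach , all | yes a~b =
      redirect ∘ f , reach′ , (λ _ → trans fa (sym fb)) ∷ All.map (cong redirect ∘_) all
      where
      redirect : Fin n → Fin n
      redirect x with x Fin.≟ f a
      ... | yes _ = f b
      ... | no  _ = x

      fa : redirect (f a) ≡ f b
      fa with f a Fin.≟ f a
      ... | yes _    = refl
      ... | no fa≢fa = contradiction refl fa≢fa

      fb : redirect (f b) ≡ f b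
      fb with f b Fin.≟ f a
      ... | yes _ = refl
      ... | no  _ = refl

      reach′ : ∀ v → Star _~_ v (redirect (f v))
      reach′ v with f v Fin.≟ f a
      ... | no  _     = reach v
      ... | yes fv≡fa =
        subst (Star _~_ v) fv≡fa (reach v) ◅◅ reverse ~-sym (reach a) ◅◅ a~b ◅ reach b

    components = merge (cartesianProduct (allFin n) (allFin n))

  representative : Fin n → Fin n
  representative = proj₁ components

  representative-reachable : ∀ v → Star _~_ v (representative v)
  representative-reachable = proj₁ (proj₂ components)

  representative-cong : ∀ {u v} → Star _~_ u v → representative u ≡ representative v
  representative-cong ε           = refl
  representative-cong (_◅_ {i = u} {j = w} u~w w⋯v) = trans
    (All.lookup (proj₂ (proj₂ components))
      (∈-cartesianProduct⁺ (∈-allFin u) (∈-allFin w)) u~w)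
    (representative-cong w⋯v)

  component : Fin n → Fin n → Bool
  component r v = ⌊ representative v Fin.≟ representative r ⌋

  component-intro : ∀ r v → representative v ≡ representative r → T (component r v)
  component-intro r v = fromWitness {a? = representative v Fin.≟ representative r}

  component-elim : ∀ r v → T (component r v) → representative v ≡ representative r
  component-elim r v = toWitness {a? = representative v Fin.≟ representative r}

  component-reachable : ∀ r v → T (component r v) → Star _~_ r v
  component-reachable r v v∈r =
    subst (Star _~_ r) (sym (component-elim r v v∈r)) (representative-reachable r)
    ◅◅ reverse ~-sym (representative-reachable v)

  component-isComponent : ∀ r → IsComponent graph (component r)
  component-isComponent r = r , λ v →
    mk⇔ (component-reachable r v) (component-intro r v ∘ sym ∘ representative-cong)

  private
    component-connected : ∀ r (u v : Vertex (induced graph (component r))) →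
                          Star _~_ (proj₁ u) (proj₁ v) →
                          Star (Graph._~_ (induced graph (component r))) u v
    component-connected r u v ε with ΣT-≡ (component r) {u} {v} refl
    ... | refl = ε
    component-connected r (u , p) v (_◅_ {j = w} u~w w⋯v) =
      u~w ◅ component-connected r (w , component-intro r w
        (trans (sym (representative-cong (u~w ◅ ε))) (component-elim r u p))) v w⋯v

    ConnectedTree : ℕ → Fin n → Set
    ConnectedTree h r = HasTreeOfHeight≤ (induced graph (component r)) h

    restrict : EliminationOrder graph h → ∀ S → EliminationOrder (induced graph S) h
    restrict order S = record
      { _⊏_        = _⊏_ on proj₁
      ; _⊏?_       = λ u v → proj₁ u ⊏? proj₁ v
      ; ⊏-trans    = ⊏-trans
      ; semilinear = λ p q → Sum.map₂ (Sum.map₁ (ΣT-≡ S)) (semilinear p q)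
      ; comparable = comparable
      ; depth      = depth ∘ proj₁
      ; depth-mono = depth-mono
      ; depth≤     = depth≤ ∘ proj₁
      }
      where open EliminationOrder order

    connectedTree : EliminationOrder graph h → ∀ r → ConnectedTree h r
    connectedTree order r = eliminationOrder⇒hasTree (search-ΣT (component r))
      (restrict order (component r)) (r , component-intro r r refl)
      λ u → component-connected r _ u (component-reachable r (proj₁ u) (proj₂ u))

    leastTree : ∀ r → ConnectedTree h r →
                ∃[ k ] ConnectedTreeDepth (induced graph (component r)) k × k ≤ h
    leastTree r = least (hasTree? ~-sym ~-irrefl _~?_ (component r))

    -- The numbering of the vertices is an elimination order of any graph. Its crude height gives
    -- every component some tree, from which the search for the least height can start.
    linearOrder : EliminationOrder graph n
    linearOrder = record
      { _⊏_        = FinBase._<_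
      ; _⊏?_       = Fin._<?_
      ; ⊏-trans    = Fin.<-trans
      ; semilinear = λ {u} {v} _ _ → total u v
      ; comparable = λ {u} {v} u~v → adjacent u~v (total u v)
      ; depth      = toℕ
      ; depth-mono = id
      ; depth≤     = λ v → ℕ.<⇒≤ (Fin.toℕ<n v)
      }
      where
      total : ∀ u v → u FinBase.< v ⊎ u ≡ v ⊎ v FinBase.< u
      total u v with Fin.<-cmp u v
      ... | tri< u<v _ _ = inj₁ u<v
      ... | tri≈ _ u≡v _ = inj₂ (inj₁ u≡v)
      ... | tri> _ _ v<u = inj₂ (inj₂ v<u)

      adjacent : ∀ {u v} → u ~ v → u FinBase.< v ⊎ u ≡ v ⊎ v FinBase.< u →
                 u FinBase.< v ⊎ v FinBase.< u
      adjacent u~v (inj₁ u<v)        = inj₁ u<v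
      adjacent u~v (inj₂ (inj₁ u≡v)) = contradiction u~v (~-irrefl u≡v)
      adjacent u~v (inj₂ (inj₂ v<u)) = inj₂ v<u

  -- The least height for the component of `r` exists by search, and the maximality in `TreeDepth`
  -- bounds it by `h`.
  treeDepth⇒hasTree : TreeDepth graph h → ∀ r → HasTreeOfHeight≤ (induced graph (component r)) h
  treeDepth⇒hasTree (_ , max) r =
    let k , (tree , min) , _ = leastTree r (connectedTree linearOrder r)
    in hasTree-mono {G = induced graph (component r)}
         (max k (component r , component-isComponent r , tree , min)) tree

  private
    -- The maximum ranges over all Boolean predicates `S`, but each that is a component agrees with
    -- the `component` of its vertex `s`. Trees move across, so the finitely many computed heights
    -- suffice.
    greatest : .{{NonZero n}} →
               (∀ r → ∃[ k ] ConnectedTreeDepth (induced graph (component r)) k × k ≤ h) →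
               ∃[ d ] TreeDepth graph d × d ≤ h
    greatest {h} td = depthOf r ,
      ((component r , component-isComponent r , proj₁ (proj₂ (td r))) , bound) ,
      proj₂ (proj₂ (td r))
      where
      depthOf : Fin n → ℕ
      depthOf s = proj₁ (td s)

      r : Fin n
      r = argmax depthOf (fromℕ< (>-nonZero⁻¹ n)) (allFin n)

      depthOf≤ : ∀ s → depthOf s ≤ depthOf r
      depthOf≤ s = All.lookup
        (f[xs]≤f[argmax] {f = depthOf} (fromℕ< (>-nonZero⁻¹ n)) (allFin n)) (∈-allFin s)

      bound : ∀ k → ∃[ S ] IsComponent graph S × ConnectedTreeDepth (induced graph S) k →
              k ≤ depthOf r
      bound k (S , (s , S⇔) , _ , min) = ℕ.≤-trans (min (depthOf s) tree) (depthOf≤ s)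
        where
        to : Vertex (induced graph (component s)) → Vertex (induced graph S)
        to (v , p) = v , Equivalence.from (S⇔ v) (component-reachable s v p)

        from : Vertex (induced graph S) → Vertex (induced graph (component s))
        from (v , p) = v , component-intro s v (sym (representative-cong (Equivalence.to (S⇔ v) p)))

        tree : HasTreeOfHeight≤ (induced graph S) (depthOf s)
        tree = hasTree-map {G = induced graph (component s)} {H = induced graph S} to from
          (λ _ → ΣT-≡ S refl) (λ _ → ΣT-≡ (component s) refl) id (proj₁ (proj₁ (proj₂ (td s))))

  eliminationOrder⇒treeDepth : .{{NonZero n}} → EliminationOrder graph h →
                               ∃[ d ] TreeDepth graph d × d ≤ h
  eliminationOrder⇒treeDepth order = greatest λ r → leastTree r (connectedTree order r)

-- Homomorphisms and cores

module _ {σ : Vocabulary} where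

  someElement : (A : Structure σ) → Universe A
  someElement A = fromℕ< (>-nonZero⁻¹ size {{nonEmpty}})
    where open Structure A

  isHom-∘ : (A B C : Structure σ) → ∀ {f g} → IsHom B C g → IsHom A B f → IsHom A C (g ∘ f)
  isHom-∘ A B C {f} {g} g-hom f-hom R t Rt =
    subst (Holds C R) (sym (map-∘ g f t)) (g-hom R (map f t) (f-hom R t Rt))

  isHom-resp : (A B : Structure σ) → ∀ {f g} → f ≗ g → IsHom A B f → IsHom A B g
  isHom-resp A B f≗g f-hom R t Rt = subst (Holds B R) (map-cong f≗g t) (f-hom R t Rt)

  isHom? : (A B : Structure σ) → Decidable (IsHom A B)
  isHom? A B f = search-∀ search-Fin λ R → search-∀ (search-Vec search-Fin) λ t →
    T? (Structure.rel A R t) →-dec T? (Structure.rel B R (map f t))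

  gaifman? : (A : Structure σ) → Decidable₂ (Graph._~_ (gaifman A))
  gaifman? A u v = ¬? (u Fin.≟ v) ×-dec search-Fin λ R → search-Vec search-Fin λ t →
    T? (Structure.rel A R t) ×-dec (u ∈? t) ×-dec (v ∈? t)
    where open VecMembership Fin._≟_ using (_∈?_)

  -- As `z` is missed, `f` already maps into the substructure induced on the other elements,
  -- renumbered by `punchIn z`; the values of `f` make it non-empty.
  retract : (A : Structure σ) → ∀ {f} → IsHom A A f → (z : Universe A) → (∀ x → f x ≢ z) →
            Σ[ C ∈ Structure σ ] suc (Structure.size C) ≡ Structure.size A ×
            C IsSubstructureOf A × Hom A C
  retract A@record { size = suc m ; rel = rel } {f} f-hom z missed =
    C , refl , (punchIn z , Fin.punchIn-injective z _ _ , λ _ _ → id) , g , g-hom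
    where
    g : Fin (suc m) → Fin m
    g x = punchOut (missed x ∘ sym)

    C : Structure σ
    C = record { size = m ; nonEmpty = Fin.nonZeroIndex (g zero)
               ; rel = λ R → rel R ∘ map (punchIn z) }

    g-hom : IsHom A C g
    g-hom R t Rt = subst (Holds A R)
      (trans (map-cong (λ x → sym (Fin.punchIn-punchOut (missed x ∘ sym))) t)
        (map-∘ (punchIn z) g t))
      (f-hom R t Rt)

injective⇒surjective : {f : Fin n → Fin n} → Injective _≡_ _≡_ f → ∀ y → ∃[ x ] f x ≡ y
injective⇒surjective {suc n} {f} f-inj y with any? (λ x → f x Fin.≟ y)
... | yes p = p
... | no ∄x = contradiction
  (Fin.injective⇒≤ {f = λ x → punchOut {i = y} (λ y≡fx → ∄x (x , sym y≡fx))}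
    (λ eq → f-inj (Fin.punchOut-injective {i = y} _ _ eq)))
  (ℕ.<⇒≱ (ℕ.n<1+n n))

-- A section of `f` is injective, hence surjective on a finite set, hence a two-sided inverse.
surjective⇒injective : {f : Fin n → Fin n} → (∀ y → ∃[ x ] f x ≡ y) → Injective _≡_ _≡_ f
surjective⇒injective {n} {f} surj {x} {y} fx≡fy =
  trans (sym (section-f x)) (trans (cong section fx≡fy) (section-f y))
  where
  section : Fin n → Fin n
  section = proj₁ ∘ surj

  section-injective : Injective _≡_ _≡_ section
  section-injective {u} {v} eq = trans (sym (proj₂ (surj u))) (trans (cong f eq) (proj₂ (surj v)))

  section-f : ∀ x → section (f x) ≡ x
  section-f x with injective⇒surjective section-injective x
  ... | y , refl = cong section (proj₂ (surj y))

module _ {σ : Vocabulary} where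

  private
    -- An endomorphism that misses an element leads to a smaller structure, and `n` bounds the
    -- repetitions. If there is none, every endomorphism is surjective, hence injective, and `A` is
    -- its own core.
    core-bounded : ∀ n (A : Structure σ) → Structure.size A ≤ n → ∃[ C ] C IsCoreOf A
    core-bounded zero    A A≤n =
      contradiction (Fin.toℕ<n (someElement A)) (ℕ.≤⇒≯ (ℕ.≤-trans A≤n z≤n))
    core-bounded (suc n) A A≤n
      with search-Π search-Fin {λ f → IsHom A A f × ∃[ z ] (∀ x → f x ≢ z)}
             (λ f≗g (f-hom , z , missed) →
               isHom-resp A A f≗g f-hom , z , λ x → missed x ∘ trans (f≗g x))
             (λ f → isHom? A A f ×-dec any? λ z → all? λ x → ¬? (f x Fin.≟ z))
    ... | yes (f , f-hom , z , missed) =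
      let A′ , size-A′ , (ι , ι-inj , ι-hom) , (r , r-hom) = retract A f-hom z missed
          C , core , (κ , κ-inj , κ-hom) , (s , s-hom) =
            core-bounded n A′ (ℕ.≤-pred (subst (_≤ suc n) (sym size-A′) A≤n))
      in C , core , (ι ∘ κ , κ-inj ∘ ι-inj , isHom-∘ C A′ A ι-hom κ-hom) ,
         (s ∘ r , isHom-∘ A A′ C s-hom r-hom)
    ... | no ∄f = A , (λ f f-hom → surjective⇒injective (onto f f-hom)) ,
      (id , id , id-hom) , (id , id-hom)
      where
      id-hom : IsHom A A id
      id-hom R t Rt = subst (Holds A R) (sym (map-id t)) Rt

      onto : ∀ f → IsHom A A f → ∀ y → ∃[ x ] f x ≡ y
      onto f f-hom y = decidable-stable (any? λ x → f x Fin.≟ y)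
        λ ∄x → ∄f (f , f-hom , y , λ x fx≡y → ∄x (x , fx≡y))

  core : (A : Structure σ) → ∃[ C ] C IsCoreOf A
  core A = core-bounded (Structure.size A) A ℕ.≤-refl

-- The game with single pebbles

dom⁺ : {f : Fin n → Maybe Y} → ∀ {x y} → f x ≡ just y → x ∈ˢ dom f
dom⁺ {x = x} eq = lookup⇒[]= x _ (trans (lookup∘tabulate _ x) (cong is-just eq))

dom⁻ : (f : Fin n → Maybe Y) → ∀ {x} → x ∈ˢ dom f → ∃[ y ] f x ≡ just y
dom⁻ f {x} x∈ with f x | trans (sym (lookup∘tabulate (is-just ∘ f) x)) ([]=⇒lookup x∈)
... | just y | _ = y , refl

p∪q─p⊆q : (p q : Subset n) → (p ∪ q) ─ p ⊆ˢ q
p∪q─p⊆q (inside  ∷ p) (b      ∷ q) (there x∈)  = there (p∪q─p⊆q p q x∈)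
p∪q─p⊆q (outside ∷ p) (inside ∷ q) here = here
p∪q─p⊆q (outside ∷ p) (b      ∷ q) (there x∈)  = there (p∪q─p⊆q p q x∈)

-- Splits off the part that one pebble covers. `q` may be empty, since a round may place fewer
-- pebbles than it is allowed.
splitOne : (p : Subset n) → ∣ p ∣ ≤ suc k → ∃[ q ] q ⊆ˢ p × ∣ q ∣ ≤ 1 × ∣ p ─ q ∣ ≤ k
splitOne []            _     = [] , id , z≤n , z≤n
splitOne (outside ∷ p) p≤k+1 with splitOne p p≤k+1
... | q , q⊆p , q≤1 , p─q≤k = outside ∷ q , (λ { (there x∈q) → there (q⊆p x∈q) }) , q≤1 , p─q≤k
splitOne {suc n} (inside ∷ p) (s≤s p≤k) =
  ⁅ zero ⁆ , (λ { here → here ; (there x∈∅) → there (⊥⊆ x∈∅) }) ,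
  ℕ.≤-reflexive (∣⁅x⁆∣≡1 (zero {n})) , subst (λ q → ∣ q ∣ ≤ _) (sym (p─⊥≡p p)) p≤k

∣p∣≤1⇒x≡y : {p : Subset n} → ∣ p ∣ ≤ 1 → ∀ {x y} → x ∈ˢ p → y ∈ˢ p → x ≡ y
∣p∣≤1⇒x≡y {p = p} p≤1 {x} {y} x∈p y∈p = decidable-stable (x Fin.≟ y) λ x≢y →
  ℕ.n≮0 (ℕ.<-≤-trans (x∈p⇒∣p-x∣<∣p∣ (x∈p∧x≢y⇒x∈p-y x∈p x≢y))
    (ℕ.≤-pred (ℕ.<-≤-trans (x∈p⇒∣p-x∣<∣p∣ y∈p) p≤1)))

module Positions {σ : Vocabulary} (A B : Structure σ) (m : ℕ)
                 (strategy : WinningStrategy (ones (suc m)) A B) where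
  open WinningStrategy strategy

  -- Position k holds the maps reached after k rounds, so 0 precedes the first round.
  Position : ℕ → PartialHom A B → Set
  Position zero    g = Empty (domain g)
  Position (suc k) g = ∃[ i ] toℕ i ≡ k × W i g

  start : ∃[ g ] Position 0 g
  start = partialHom (λ _ → nothing) (inj₁ empty) , empty
    where
    empty : Empty (dom {Structure.size A} {Universe B} (λ _ → nothing))
    empty (x , x∈) with dom⁻ {Y = Universe B} (λ _ → nothing) x∈
    ... | _ , ()

  -- Treats `initial` as a move from the empty map, so that the first round has the same form as the
  -- later ones.
  respond : k < suc m → (g : PartialHom A B) → Position k g →
            ∀ S → domain g ⊆ˢ S → ∣ S ─ domain g ∣ ≤ 1 →
            ∃[ g′ ] Position (suc k) g′ × domain g′ ≡ S × g′ Extends g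
  respond {zero} _ g empty S _ S≤1
    with initial S (ℕ.≤-trans
           (p⊆q⇒∣p∣≤∣q∣ {p = S} λ x∈S → x∈p∧x∉q⇒x∈p─q x∈S λ x∈g → empty (_ , x∈g)) S≤1)
  ... | g′ , g′∈W , dom≡S = g′ , (zero , refl , g′∈W) , dom≡S , λ a b ga≡b →
    contradiction (a , dom⁺ ga≡b) empty
  respond {suc k} (s≤s k<m) g (i , i≡k , g∈W) S dom⊆S S≤1
    with forth (fromℕ< k<m) g (subst (λ i → W i g) i≡j g∈W) S dom⊆S
           (subst (∣ S ─ domain g ∣ ≤_) (sym (lookup-replicate (fromℕ< k<m) 1)) S≤1)
    where
    i≡j : i ≡ inject₁ (fromℕ< k<m)
    i≡j = Fin.toℕ-injective (trans i≡k (sym (trans (Fin.toℕ-inject₁ _) (Fin.toℕ-fromℕ< k<m))))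
  ... | g′ , g′∈W , dom≡S , extends =
    g′ , (suc (fromℕ< k<m) , cong suc (Fin.toℕ-fromℕ< k<m) , g′∈W) , dom≡S , extends

  -- Missing elements are added at most one at a time; when they run out early, the remaining rounds
  -- add nothing.
  respondMany : ∀ p → k + p ≤ suc m → (g : PartialHom A B) → Position k g →
                ∀ S → domain g ⊆ˢ S → ∣ S ─ domain g ∣ ≤ p →
                ∃[ g′ ] Position (k + p) g′ × domain g′ ≡ S × g′ Extends g
  respondMany {k} zero _ g pos S dom⊆S S≤0 =
    g , subst (λ l → Position l g) (sym (ℕ.+-identityʳ k)) pos , ⊆-antisym dom⊆S S⊆dom , λ _ _ → id
    where
    S⊆dom : S ⊆ˢ domain g
    S⊆dom {x} x∈S = decidable-stable (x ∈ˢ? domain g) λ x∉g →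
      ℕ.n≮0 (ℕ.<-≤-trans (x∈p⇒∣p-x∣<∣p∣ (x∈p∧x∉q⇒x∈p─q x∈S x∉g)) S≤0)
  respondMany {k} (suc p) k+p<n g pos S dom⊆S S≤p with splitOne (S ─ domain g) S≤p
  ... | q , q⊆ , q≤1 , rest≤p
    with respond (ℕ.≤-trans (s≤s (ℕ.m≤m+n k p)) (subst (_≤ suc m) (ℕ.+-suc k p) k+p<n)) g pos
           (domain g ∪ q) (p⊆p∪q q) (ℕ.≤-trans (p⊆q⇒∣p∣≤∣q∣ (p∪q─p⊆q (domain g) q)) q≤1)
  ... | g₁ , pos₁ , dom₁ , extends₁
    with respondMany p (subst (_≤ suc m) (ℕ.+-suc k p) k+p<n) g₁ pos₁ S
           (λ x∈g₁ → [ dom⊆S , p─q⊆p S (domain g) ∘ q⊆ ]′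
             (x∈p∪q⁻ (domain g) q (subst (_ ∈ˢ_) dom₁ x∈g₁)))
           (subst (λ d → ∣ S ─ d ∣ ≤ p) (sym dom₁)
             (subst (λ d → ∣ d ∣ ≤ p) (p─q─r≡p─q∪r S (domain g) q) rest≤p))
  ... | g₂ , pos₂ , dom₂ , extends₂ =
    g₂ , subst (λ l → Position l g₂) (sym (ℕ.+-suc k p)) pos₂ , dom₂ ,
    λ a b → extends₂ a b ∘ extends₁ a b

  place : k < suc m → (g : PartialHom A B) → Position k g → ∀ x →
          ∃[ g′ ] Position (suc k) g′ × x ∈ˢ domain g′ × g′ Extends g
  place k<n g pos x
    with respond k<n g pos (domain g ∪ ⁅ x ⁆) (p⊆p∪q ⁅ x ⁆)
           (ℕ.≤-trans (p⊆q⇒∣p∣≤∣q∣ (p∪q─p⊆q (domain g) ⁅ x ⁆)) (ℕ.≤-reflexive (∣⁅x⁆∣≡1 x)))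
  ... | g′ , pos′ , dom≡ , extends =
    g′ , pos′ , subst (x ∈ˢ_) (sym dom≡) (q⊆p∪q (domain g) ⁅ x ⁆ (x∈⁅x⁆ x)) , extends

-- Grouping pebbles into fewer rounds

-- Entry `i` is included: this is the number of single pebbles spent once round `i` is over.
partialSum : Vec ℕ n → Fin n → ℕ
partialSum (x ∷ xs) zero    = x
partialSum (x ∷ xs) (suc i) = x + partialSum xs i

partialSum-suc : (xs : Vec ℕ (suc n)) (i : Fin n) →
                 partialSum xs (suc i) ≡ partialSum xs (inject₁ i) + lookup xs (suc i)
partialSum-suc (x ∷ y ∷ xs) zero    = refl
partialSum-suc (x ∷ xs)     (suc i) =
  trans (cong (x +_) (partialSum-suc xs i)) (sym (ℕ.+-assoc x _ _))

partialSum≤sum : (xs : Vec ℕ n) (i : Fin n) → partialSum xs i ≤ sum xs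
partialSum≤sum (x ∷ xs) zero    = ℕ.m≤m+n x (sum xs)
partialSum≤sum (x ∷ xs) (suc i) = ℕ.+-monoʳ-≤ x (partialSum≤sum xs i)

pebbles-ones : ∀ n .{{_ : NonZero n}} → pebbles (ones n) ≡ n
pebbles-ones (suc n) = cong suc (sum-ones n)
  where
  sum-ones : ∀ n → sum (replicate n 1) ≡ n
  sum-ones zero    = refl
  sum-ones (suc n) = cong suc (sum-ones n)

-- Only the positions at the ends of grouped rounds are kept. If the vector begins with zeros, these
-- include position 0, before any single pebble is placed.
regroup : ∀ {σ} {A B : Structure σ} (v : GameVector) n .{{_ : NonZero n}} → pebbles v ≡ n →
          WinningStrategy (ones n) A B → WinningStrategy v A B
regroup {A = A} {B} (r , p) (suc m) sum≡n strategy = record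
  { W       = λ i → Position (partialSum p i)
  ; initial = λ S S≤p →
      let g , empty = start
          g′ , pos , dom≡S , _ = respondMany (partialSum p zero) (partialSum≤ zero) g empty S
            (λ x∈g → contradiction (_ , x∈g) empty)
            (ℕ.≤-trans (∣p─q∣≤∣p∣ S (domain g)) (ℕ.≤-trans S≤p (ℕ.≤-reflexive (head≡ p))))
      in g′ , pos , dom≡S
  ; forth   = λ i g pos S dom⊆S S≤p →
      let g′ , pos′ , dom≡S , extends = respondMany (lookup p (suc i))
            (subst (_≤ suc m) (partialSum-suc p i) (partialSum≤ (suc i))) g pos S dom⊆S S≤p
      in g′ , subst (λ k → Position k g′) (sym (partialSum-suc p i)) pos′ , dom≡S , extends
  }
  where
  open Positions A B m strategy

  partialSum≤ : ∀ i → partialSum p i ≤ suc m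
  partialSum≤ i = ℕ.≤-trans (partialSum≤sum p i) (ℕ.≤-reflexive sum≡n)

  head≡ : (xs : Vec ℕ (suc n)) → lookup xs zero ≡ partialSum xs zero
  head≡ (x ∷ xs) = refl

-- Spoiler descends elimination trees

module TreePlay {σ : Vocabulary} (A B : Structure σ) (m : ℕ)
                (strategy : WinningStrategy (ones (suc m)) A B)
                {V : Set} (F : RootedTree V) (height : RootedTree.Height≤ F m)
                (pebble : V → Universe A) where
  open Positions A B m strategy
  open RootedTree F

  private
    -- Spoiler pebbles the path from the root downwards, so a vertex at depth `k` is reached after
    -- `suc k` rounds and the height bound keeps within `suc m`. `advance` is separate because it
    -- also records that the answer at a child extends the one at its parent.
    play : ∀ {v k} → Path parent root v k →
           ∃[ g ] Position (suc k) g × pebble v ∈ˢ domain g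
    advance : ∀ {u v k} (P : Path parent root u k) (e : parent v ≡ just u) →
              ∃[ g′ ] Position (suc (suc k)) g′ × pebble v ∈ˢ domain g′ × g′ Extends proj₁ (play P)

    play here =
      let g , empty = start
          g′ , pos , v∈ , _ = place (s≤s z≤n) g empty (pebble root)
      in g′ , pos , v∈
    play (down P e) = let g′ , pos , v∈ , _ = advance P e in g′ , pos , v∈

    advance {v = v} P e = let g , pos , _ = play P in
      place (s≤s (height _ _ (down P e))) g pos (pebble v)

    play-extends : ∀ {u v j k} (P : Path parent root u j) (Q : Path parent u v k) →
                   proj₁ (play (path-++ P Q)) Extends proj₁ (play P)
    play-extends P here       a b = id
    play-extends P (down Q e) a b =
      proj₂ (proj₂ (proj₂ (advance (path-++ P Q) e))) a b ∘ play-extends P Q a b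

  answer : V → PartialHom A B
  answer v = proj₁ (play (proj₂ (rooted v)))

  pebble∈answer : ∀ v → pebble v ∈ˢ domain (answer v)
  pebble∈answer v = proj₂ (proj₂ (play (proj₂ (rooted v))))

  -- By uniqueness the chosen path to `v` is the chosen path to `u` continued by `Q`, so the play
  -- for `v` passes through the answer at `u`.
  answer-extends : ∀ {u v} → Ancestor u v → answer v Extends answer u
  answer-extends {u} {v} (_ , Q) =
    subst (λ (_ , P) → proj₁ (play P) Extends answer u)
      (path-unique root-parent (path-++ (proj₂ (rooted u)) Q) (proj₂ (rooted v)))
      (play-extends (proj₂ (rooted u)) Q)

-- Gluing compatible answers into a homomorphism

private
  maximum : {_≼_ : Rel X 0ℓ} → Transitive _≼_ → (xs : Vec X (suc n)) →
            (∀ {x y} → x ∈ xs → y ∈ xs → x ≼ y ⊎ y ≼ x) →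
            ∃[ z ] z ∈ xs × (∀ {x} → x ∈ xs → x ≼ z)
  maximum ≼-trans (x ∷ []) total =
    x , here refl , λ { (here refl) → [ id , id ]′ (total (here refl) (here refl)) }
  maximum ≼-trans (x ∷ xs@(_ ∷ _)) total
    with maximum ≼-trans xs (λ p q → total (there p) (there q))
  ... | y , y∈xs , max with total (here refl) (there y∈xs)
  ... | inj₁ x≼y = y , there y∈xs , λ { (here refl) → x≼y ; (there p) → max p }
  ... | inj₂ y≼x = x , here refl , λ
    { (here refl) → [ id , id ]′ (total (here refl) (here refl))
    ; (there p)   → ≼-trans (max p) y≼x }

-- The default element serves the empty tuples of nullary relations.
upperBound : {_≼_ : Rel X 0ℓ} → Transitive _≼_ → X → (xs : Vec X n) →
             (∀ {x y} → x ∈ xs → y ∈ xs → x ≼ y ⊎ y ≼ x) → ∃[ z ] (∀ {x} → x ∈ xs → x ≼ z)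
upperBound ≼-trans z []         total = z , λ ()
upperBound ≼-trans z xs@(_ ∷ _) total = let y , _ , max = maximum ≼-trans xs total in y , max

map-cong-∈ : {f g : X → Y} (xs : Vec X n) → (∀ {x} → x ∈ xs → f x ≡ g x) → map f xs ≡ map g xs
map-cong-∈ []       eq = refl
map-cong-∈ (x ∷ xs) eq = cong₂ _∷_ (eq (here refl)) (map-cong-∈ xs (eq ∘ there))

module _ {σ : Vocabulary} where

  -- A tuple of C is a clique of the Gaifman graph, so one answer covers it.
  glue : (A B C : Structure σ) {ι : Universe C → Universe A} → IsHom C A ι →
         (answer : Universe C → PartialHom A B) → (∀ u → ι u ∈ˢ domain (answer u)) →
         (∀ {u v} → Graph._~_ (gaifman C) u v →
            answer v Extends answer u ⊎ answer u Extends answer v) →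
         Hom C B
  glue A B C {ι} ι-hom answer ι∈ compatible = f , f-hom
    where
    f : Universe C → Universe B
    f u = proj₁ (dom⁻ (apply (answer u)) (ι∈ u))

    f-hom : IsHom C B f
    f-hom R t Rt with upperBound {_≼_ = λ u v → answer v Extends answer u}
                        (λ uv vw a b → vw a b ∘ uv a b) (someElement C) t total
      where
      total : ∀ {u v} → u ∈ t → v ∈ t → answer v Extends answer u ⊎ answer u Extends answer v
      total {u} {v} u∈t v∈t with u Fin.≟ v
      ... | yes refl = inj₁ λ _ _ → id
      ... | no u≢v   = compatible (u≢v , R , t , Rt , u∈t , v∈t)
    ... | z , max with isPHom (answer z)
    -- A pebbled vertex rules out the empty map, which could violate a nullary relation; for a
    -- nullary `R`, `z` is the default vertex.
    ... | inj₁ empty     = contradiction (_ , ι∈ z) empty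
    ... | inj₂ (_ , hom) = hom R (map ι t) (map f t) (ι-hom R t Rt)
      (trans (sym (map-∘ (apply (answer z)) ι t))
        (trans (map-cong-∈ t λ {u} u∈t →
            max u∈t (ι u) (f u) (proj₂ (dom⁻ (apply (answer u)) (ι∈ u))))
          (map-∘ just f t)))

  -- Every component is played on separately along its own tree. Answers from different components
  -- are never compared, as edges stay within one component.
  spoilerWins : (A B C : Structure σ) → C IsSubstructureOf A →
                TreeDepth (gaifman C) h → h ≤ m →
                WinningStrategy (ones (suc m)) A B → Hom C B
  spoilerWins {h} {m} A B C (ι , _ , ι-hom) td h≤m strategy =
    glue A B C ι-hom (λ u → answer (representative u) (member u))
      (λ u → pebble∈answer (representative u) (member u))
      (λ {u} {v} u~v → compatible (representative-cong (u~v ◅ ε)) (member u) (member v) u~v)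
    where
    open FiniteGraph (Graph.sym (gaifman C)) (Graph.irrefl (gaifman C)) (gaifman? C)

    tree : ∀ r → HasTreeOfHeight≤ (induced graph (component r)) m
    tree r = hasTree-mono {G = induced graph (component r)} h≤m (treeDepth⇒hasTree td r)

    module Play r = TreePlay A B m strategy (proj₁ (tree r)) (proj₁ (proj₂ (tree r))) (ι ∘ proj₁)
    open Play

    member : ∀ u → Vertex (induced graph (component (representative u)))
    member u = u , component-intro (representative u) u
      (representative-cong (representative-reachable u))

    -- Representatives of adjacent vertices agree only propositionally, while the types of `u` and
    -- `v` depend on them; hence the equation `r ≡ s`.
    compatible : ∀ {r s} → r ≡ s →
                 (u : Vertex (induced graph (component r)))
                 (v : Vertex (induced graph (component s))) →
                 Graph._~_ graph (proj₁ u) (proj₁ v) →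
                 answer s v Extends answer r u ⊎ answer r u Extends answer s v
    compatible {r} refl u v u~v =
      Sum.map (answer-extends r) (answer-extends r) (proj₂ (proj₂ (tree r)) u v u~v)

-- Unravelling

module Unravelling {σ : Vocabulary} (C : Structure σ) (m : ℕ) where
  open Structure C using (size)

  -- A code represents the sequence of its first level + 1 entries; the
  -- remaining entries are junk, so codes of a sequence are not unique.
  Code : Set
  Code = Fin (suc m * size ^ suc m)

  level : Code → Fin (suc m)
  level x = proj₁ (remQuot {suc m} (size ^ suc m) x)

  entry : Code → Fin (suc m) → Universe C
  entry x = finToFun (proj₂ (remQuot {suc m} (size ^ suc m) x))

  code : Fin (suc m) → (Fin (suc m) → Universe C) → Code
  code k f = combine k (funToFin f)

  level-code : ∀ k f → level (code k f) ≡ k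
  level-code k f = cong proj₁ (Fin.remQuot-combine k (funToFin f))

  entry-code : ∀ k f → entry (code k f) ≗ f
  entry-code k f i = trans
    (cong (λ p → finToFun (proj₂ p) i) (Fin.remQuot-combine k (funToFin f)))
    (Fin.finToFun-funToFin f i)

  tip : Code → Universe C
  tip x = entry x (level x)

  -- The prefix order on the coded sequences. It is only a preorder, as codes that differ just in
  -- their junk lie below each other.
  _⊑_ : Rel Code 0ℓ
  x ⊑ y = toℕ (level x) ≤ toℕ (level y) ×
          (∀ i → toℕ i ≤ toℕ (level x) → entry x i ≡ entry y i)

  _⊑?_ : Decidable₂ _⊑_
  x ⊑? y = (toℕ (level x) ℕ.≤? toℕ (level y)) ×-dec
           all? (λ i → (toℕ i ℕ.≤? toℕ (level x)) →-dec (entry x i Fin.≟ entry y i))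

  ⊑-refl : ∀ {x} → x ⊑ x
  ⊑-refl = ℕ.≤-refl , λ _ _ → refl

  ⊑-trans : Transitive _⊑_
  ⊑-trans (x≤y , xy) (y≤z , yz) =
    ℕ.≤-trans x≤y y≤z , λ i i≤x → trans (xy i i≤x) (yz i (ℕ.≤-trans i≤x x≤y))

  Comparable : Rel Code 0ℓ
  Comparable x y = x ⊑ y ⊎ y ⊑ x

  ⊑-semilinear : ∀ {x y z} → x ⊑ z → y ⊑ z → Comparable x y
  ⊑-semilinear {x} {y} (_ , xz) (_ , yz) with ℕ.≤-total (toℕ (level x)) (toℕ (level y))
  ... | inj₁ x≤y = inj₁ (x≤y , λ i i≤x → trans (xz i i≤x) (sym (yz i (ℕ.≤-trans i≤x x≤y))))
  ... | inj₂ y≤x = inj₂ (y≤x , λ i i≤y → trans (yz i i≤y) (sym (xz i (ℕ.≤-trans i≤y y≤x))))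

  ⊑-tip : ∀ {x y} → x ⊑ y → toℕ (level x) ≡ toℕ (level y) → tip x ≡ tip y
  ⊑-tip {x} {y} (_ , xy) eq = trans (xy (level x) ℕ.≤-refl) (cong (entry y) (Fin.toℕ-injective eq))

  Tuple : (R : Fin (symbols σ)) → Vec Code (arity σ R) → Set
  Tuple R t = AllV (λ x → AllV (Comparable x) t) t × Holds C R (map tip t)

  tuple? : ∀ R → Decidable (Tuple R)
  tuple? R t = AllV.all? (λ x → AllV.all? (λ y → (x ⊑? y) ⊎-dec (y ⊑? x)) t) t ×-dec T? _

  unravelling : Structure σ
  unravelling = record
    { size     = suc m * size ^ suc m
    ; nonEmpty = Fin.nonZeroIndex (code zero (const (someElement C)))
    ; rel      = λ R t → ⌊ tuple? R t ⌋
    }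

  tuple⁺ : ∀ {R t} → Tuple R t → Holds unravelling R t
  tuple⁺ {R} {t} = fromWitness {a? = tuple? R t}

  tuple⁻ : ∀ {R t} → Holds unravelling R t → Tuple R t
  tuple⁻ {R} {t} = toWitness {a? = tuple? R t}

  tip-hom : IsHom unravelling C tip
  tip-hom R t Rt = proj₂ (tuple⁻ {R} {t} Rt)

  -- `tip ∘ e` is an endomorphism of the core `C`, hence injective. Comparable codes of equal level
  -- have equal tips, so they come from the same vertex, and distinct adjacent vertices get
  -- different levels.
  hom⇒eliminationOrder : IsCore C → Hom C unravelling → EliminationOrder (gaifman C) m
  hom⇒eliminationOrder core (e , e-hom) = record
    { _⊏_        = _⊏_
    ; _⊏?_       = λ u v → (e u ⊑? e v) ×-dec (toℕ (level (e u)) ℕ.<? toℕ (level (e v)))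
    ; ⊏-trans    = λ (uv , u<v) (vw , v<w) → ⊑-trans uv vw , ℕ.<-trans u<v v<w
    ; semilinear = λ (uw , _) (vw , _) → strict (⊑-semilinear uw vw)
    ; comparable = λ (u≢v , R , t , Rt , u∈t , v∈t) → distinct u≢v (strict
        (AllV.lookup (AllV.lookup (proj₁ (tuple⁻ {R} {map e t} (e-hom R t Rt)))
          (∈-map⁺ e u∈t)) (∈-map⁺ e v∈t)))
    ; depth      = toℕ ∘ level ∘ e
    ; depth-mono = proj₂
    ; depth≤     = λ v → Fin.toℕ≤pred[n] (level (e v))
    }
    where
    _⊏_ : Rel (Universe C) 0ℓ
    u ⊏ v = e u ⊑ e v × toℕ (level (e u)) < toℕ (level (e v))

    tip∘e-injective : Injective _≡_ _≡_ (tip ∘ e)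
    tip∘e-injective = core (tip ∘ e) (isHom-∘ C unravelling C tip-hom e-hom)

    strict : ∀ {u v} → Comparable (e u) (e v) → u ⊏ v ⊎ u ≡ v ⊎ v ⊏ u
    strict (inj₁ uv) with ℕ.m≤n⇒m<n∨m≡n (proj₁ uv)
    ... | inj₁ u<v = inj₁ (uv , u<v)
    ... | inj₂ u≡v = inj₂ (inj₁ (tip∘e-injective (⊑-tip uv u≡v)))
    strict (inj₂ vu) with ℕ.m≤n⇒m<n∨m≡n (proj₁ vu)
    ... | inj₁ v<u = inj₂ (inj₂ (vu , v<u))
    ... | inj₂ v≡u = inj₂ (inj₁ (sym (tip∘e-injective (⊑-tip vu v≡u))))

    distinct : ∀ {u v} → u ≢ v → u ⊏ v ⊎ u ≡ v ⊎ v ⊏ u → u ⊏ v ⊎ v ⊏ u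
    distinct u≢v (inj₁ u⊏v)        = inj₁ u⊏v
    distinct u≢v (inj₂ (inj₁ u≡v)) = contradiction u≡v u≢v
    distinct u≢v (inj₂ (inj₂ v⊏u)) = inj₂ v⊏u

  -- Duplicator's strategy on the unravelling

  module Duplicator (A : Structure σ) (A→C : Hom A C) where

    private
      q     = proj₁ A→C
      q-hom = proj₂ A→C

    -- Duplicator's invariant: `x` records the history of the play, and a pebbled element is
    -- answered by a prefix of `x` that ends with its image in `C`.
    Below : Code → (Universe A → Maybe Code) → Set
    Below x f = ∀ a b → f a ≡ just b → b ⊑ x × tip b ≡ q a

    map≡just⇒All : {P : Pred Code 0ℓ} {f : Universe A → Maybe Code} →
                   (∀ {a b} → f a ≡ just b → P b) → (t : Vec (Universe A) n) (s : Vec Code n) →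
                   map f t ≡ map just s → AllV P s
    map≡just⇒All p []      []      eq = []
    map≡just⇒All p (a ∷ t) (b ∷ s) eq = p (∷-injectiveˡ eq) ∷ map≡just⇒All p t s (∷-injectiveʳ eq)

    map≡just⇒tips : {f : Universe A → Maybe Code} →
                    (∀ {a b} → f a ≡ just b → tip b ≡ q a) →
                    (t : Vec (Universe A) n) (s : Vec Code n) →
                    map f t ≡ map just s → map tip s ≡ map q t
    map≡just⇒tips p []      []      eq = refl
    map≡just⇒tips p (a ∷ t) (b ∷ s) eq =
      cong₂ _∷_ (p (∷-injectiveˡ eq)) (map≡just⇒tips p t s (∷-injectiveʳ eq))

    -- Prefixes of the one sequence `x` are pairwise comparable, and their tips are images under the
    -- homomorphism `q`: the two halves of `Tuple`.
    below⇒partialHom : ∀ {x} f → Below x f → IsPartialHom A unravelling f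
    below⇒partialHom {x} f below with nonempty? (dom f)
    ... | no empty     = inj₁ empty
    ... | yes nonempty = inj₂ (nonempty , λ R t s Rt eq →
      let all = map≡just⇒All (λ {a} {b} fa≡b → proj₁ (below a b fa≡b)) t s eq in
      tuple⁺ {R} {s} (AllV.map (λ b⊑x → AllV.map (⊑-semilinear b⊑x) all) all ,
        subst (Holds C R)
          (sym (map≡just⇒tips (λ {a} {b} fa≡b → proj₂ (below a b fa≡b)) t s eq)) (q-hom R t Rt)))

    -- `next a` is the history after adding `a`. Old answers are kept, and a newly pebbled element
    -- is answered by the entire new history.
    respond : ∀ f S → dom f ⊆ˢ S → ∣ S ─ dom f ∣ ≤ 1 → (next : Universe A → Code) →
              (∀ a → tip (next a) ≡ q a) → (∀ a → Below (next a) f) →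
              ∃[ a ] ∃[ f′ ] Below (next a) f′ × dom f′ ≡ S × (∀ c b → f c ≡ just b → f′ c ≡ just b)
    respond f S dom⊆S S≤1 next tip-next below = a , f′ , f′-below , dom≡ , extends
      where
      new : ∃[ a ] (∀ c → c ∈ˢ S ─ dom f → c ≡ a)
      new with nonempty? (S ─ dom f)
      ... | yes (a , a∈) = a , λ c c∈ → ∣p∣≤1⇒x≡y S≤1 c∈ a∈
      -- If nothing new is pebbled, an arbitrary element is recorded, so that the level still counts
      -- the rounds.
      ... | no empty     = someElement A , λ c c∈ → contradiction (c , c∈) empty

      a = proj₁ new

      f′ : Universe A → Maybe Code
      f′ c = if lookup S c then just (fromMaybe (next a) (f c)) else nothing

      dom≡ : dom f′ ≡ S
      dom≡ = trans (tabulate-cong λ c → is-just-if (lookup S c)) (tabulate∘lookup S)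
        where
        is-just-if : ∀ b {x : Code} → is-just (if b then just x else nothing) ≡ b
        is-just-if true  = refl
        is-just-if false = refl

      extends : ∀ c b → f c ≡ just b → f′ c ≡ just b
      extends c b fc≡b rewrite []=⇒lookup (dom⊆S (dom⁺ {f = f} fc≡b)) | fc≡b = refl

      f′-below : Below (next a) f′
      f′-below c b eq with lookup S c in c∈S
      f′-below c b ()   | false
      f′-below c b eq   | true with f c in fc≡
      f′-below c b refl | true | just _  = below a c b fc≡
      f′-below c b refl | true | nothing
        with proj₂ new c (x∈p∧x∉q⇒x∈p─q (lookup⇒[]= c S c∈S) λ c∈f →
               contradiction (trans (sym fc≡) (proj₂ (dom⁻ f c∈f))) λ ())
      ... | refl = ⊑-refl , tip-next c

    strategy : WinningStrategy (ones (suc m)) A unravelling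
    strategy = record { W = W ; initial = initial ; forth = forth }
      where
      -- Tying the level to the round ensures that `suc m` rounds fit into the `suc m` entries of a
      -- code.
      W : Fin (suc m) → Pred (PartialHom A unravelling) 0ℓ
      W i g = ∃[ x ] level x ≡ i × Below x (apply g)

      initial : ∀ S → ∣ S ∣ ≤ 1 → ∃[ g ] W zero g × domain g ≡ S
      initial S S≤1
        with respond (const nothing) S
               (λ x∈ → contradiction (proj₂ (dom⁻ {Y = Code} (const nothing) x∈)) λ ())
               -- At level zero only the first entry counts; the rest of the constant sequence is
               -- junk.
               (ℕ.≤-trans (∣p─q∣≤∣p∣ S _) S≤1) (λ a → code zero (const (q a)))
               (λ a → entry-code zero (const (q a)) (level (code zero (const (q a)))))
               (λ _ _ _ ())
      ... | a , f , below , dom≡ , _ =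
        partialHom f (below⇒partialHom f below) ,
        (code zero (const (q a)) , level-code zero (const (q a)) , below) , dom≡

      forth : (i : Fin m) (g : PartialHom A unravelling) → W (inject₁ i) g →
              ∀ S → domain g ⊆ˢ S → ∣ S ─ domain g ∣ ≤ lookup (replicate m 1) i →
              ∃[ g′ ] W (suc i) g′ × domain g′ ≡ S × g′ Extends g
      forth i g (x , level-x , g-below) S dom⊆S S≤ =
        let a , f , below , dom≡ , extends = respond (apply g) S dom⊆S
              (subst (∣ S ─ domain g ∣ ≤_) (lookup-replicate i 1) S≤) next tip-next
              (λ a c b gc≡b → let b⊑x , tip≡ = g-below c b gc≡b in ⊑-trans b⊑x (x⊑next a) , tip≡)
        in partialHom f (below⇒partialHom f below) ,
           (next a , level-code (suc i) (entries a) , below) , dom≡ , extends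
        where
        -- Position `suc i` lies beyond the level of `x`, so overwriting it leaves `x` a prefix.
        entries : Universe A → Fin (suc m) → Universe C
        entries a j = if ⌊ j Fin.≟ suc i ⌋ then q a else entry x j

        next : Universe A → Code
        next a = code (suc i) (entries a)

        entries-suc : ∀ a → entries a (suc i) ≡ q a
        entries-suc a with i Fin.≟ i
        ... | yes _  = refl
        ... | no i≢i = contradiction refl i≢i

        entries-old : ∀ a j → toℕ j ≤ toℕ i → entries a j ≡ entry x j
        entries-old a j j≤i with j Fin.≟ suc i
        ... | yes refl = contradiction j≤i (ℕ.<⇒≱ (ℕ.n<1+n _))
        ... | no _     = refl

        tip-next : ∀ a → tip (next a) ≡ q a
        tip-next a = trans (cong (entry (next a)) (level-code (suc i) (entries a)))
          (trans (entry-code (suc i) (entries a) (suc i)) (entries-suc a))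

        level-x≡ : toℕ (level x) ≡ toℕ i
        level-x≡ = trans (cong toℕ level-x) (Fin.toℕ-inject₁ i)

        x⊑next : ∀ a → x ⊑ next a
        x⊑next a =
          ℕ.≤-trans (ℕ.≤-reflexive level-x≡)
            (ℕ.≤-trans (ℕ.n≤1+n _) (ℕ.≤-reflexive
              (cong toℕ (sym (level-code (suc i) (entries a)))))) ,
          λ j j≤x → sym (trans (entry-code (suc i) (entries a) j)
            (entries-old a j (ℕ.≤-trans j≤x (ℕ.≤-reflexive level-x≡))))

theorem6p2 : ∀ {ℓ : Level} (𝒜 : StructureClass ℓ) (n : ℕ) .{{_ : NonZero n}} →
    ((∃[ v ] pebbles v ≡ n × Solves v 𝒜) ⇔ Solves (ones n) 𝒜) ×
    (Solves (ones n) 𝒜 ⇔ (∀ G → CoreGraphs 𝒜 G → ∃[ d ] TreeDepth G d × d < n))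
theorem6p2 𝒜 n@(suc m) =
  mk⇔ (λ (v , v≡n , solves) σ A B A∈𝒜 → solves σ A B A∈𝒜 ∘ regroup v n v≡n)
      (λ solves → ones n , pebbles-ones n , solves) ,
  mk⇔ necessary sufficient
  where
  necessary : Solves (ones n) 𝒜 → ∀ G → CoreGraphs 𝒜 G → ∃[ d ] TreeDepth G d × d < n
  necessary solves _ (graphOfCore {σ} {A} {C} A∈𝒜 (C-core , (ι , _ , ι-hom) , A→C)) =
    -- The game is played on `A`, where `Solves` applies; the inclusion of `C` in `A` then turns the
    -- map obtained into one from the core.
    let f , f-hom   = solves σ A unravelling A∈𝒜 (Duplicator.strategy A A→C)
        d , td , d≤m = eliminationOrder⇒treeDepth {{Structure.nonEmpty C}}
          (hom⇒eliminationOrder C-core (f ∘ ι , isHom-∘ C A unravelling f-hom ι-hom))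
    in d , td , s≤s d≤m
    where
    open Unravelling C m
    open FiniteGraph (Graph.sym (gaifman C)) (Graph.irrefl (gaifman C)) (gaifman? C)

  sufficient : (∀ G → CoreGraphs 𝒜 G → ∃[ d ] TreeDepth G d × d < n) → Solves (ones n) 𝒜
  sufficient bounded σ A B A∈𝒜 strategy =
    let C , C-core@(_ , C⊆A , r , r-hom) = core A
        d , td , d<n = bounded (gaifman C) (graphOfCore {A = A} {C = C} A∈𝒜 C-core)
        -- A branch with at most `m` edges has at most `suc m` vertices, one for each of the `n`
        -- pebbles.
        f , f-hom    = spoilerWins A B C C⊆A td (ℕ.≤-pred d<n) strategy
    in f ∘ r , isHom-∘ A C B f-hom r-hom
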